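{- If $G$ is a triangle-critical claw-free graph with chromatic number $8$, then $G \cong K_8$.
   Context: All graphs are finite and simple. A graph is claw-free if it has no induced subgraph isomorphic to $K_{1,3}$. For $\ell \geq 2$, a graph $G$ is called $K_{\ell}$-critical if (i) $G$ contains $K_{\ell}$ as a subgraph; (ii) $G$ is critical, i.e. removing any vertex reduces the chromatic number of $G$ by one; (iii) removing the vertex set of any copy of $K_{\ell}$ in $G$ reduces the chromatic number of $G$ by exactly $\ell$. A graph is triangle-critical if it is $K_3$-critical. -}

module Defs where

open import Data.Nat using (ℕ; _≤_)
open import Data.Fin using (Fin)
open import Data.Bool using (Bool; true; false)
open import Data.Product using (Σ; _×_; ∃-syntax)
open import Data.Unit using (⊤)
open import Relation.Nullary using (¬_)
open import Relation.Binary.PropositionalEquality using (_≡_; _≢_)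
open import Function.Bundles using (_↔_; Inverse)

record Graph : Set where
  field
    n      : ℕ
    adj    : Fin n → Fin n → Bool
    sym    : ∀ u v → adj u v ≡ adj v u
    irrefl : ∀ v → adj v v ≡ false

open Graph public

Adj : (G : Graph) → Fin (n G) → Fin (n G) → Set
Adj G u v = adj G u v ≡ true

VSet : Graph → Set₁
VSet G = Fin (n G) → Set

Colorable : (G : Graph) → VSet G → ℕ → Set
Colorable G S k =
  Σ (Fin (n G) → Fin k) λ c →
    ∀ u v → S u → S v → Adj G u v → c u ≢ c v

ChromaticNumberIs : (G : Graph) → VSet G → ℕ → Set
ChromaticNumberIs G S k = Colorable G S k × (∀ m → Colorable G S m → k ≤ m)

All : (G : Graph) → VSet G
All G _ = ⊤

Minus1 : (G : Graph) → Fin (n G) → VSet G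
Minus1 G v u = u ≢ v

Minus3 : (G : Graph) → Fin (n G) → Fin (n G) → Fin (n G) → VSet G
Minus3 G a b c u = (u ≢ a) × (u ≢ b) × (u ≢ c)

IsTriangle : (G : Graph) → Fin (n G) → Fin (n G) → Fin (n G) → Set
IsTriangle G a b c = Adj G a b × Adj G b c × Adj G a c

ClawFree : Graph → Set
ClawFree G = ∀ x a b c →
  ¬ (Adj G x a × Adj G x b × Adj G x c ×
     a ≢ b × a ≢ c × b ≢ c ×
     ¬ Adj G a b × ¬ Adj G a c × ¬ Adj G b c)

Critical : (G : Graph) → ℕ → Set
Critical G k = ChromaticNumberIs G (All G) k ×
  (∀ v → ∀ m → ChromaticNumberIs G (Minus1 G v) m → m Data.Nat.+ 1 ≡ k)

TriangleCritical : (G : Graph) → ℕ → Set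
TriangleCritical G k =
  (∃[ a ] ∃[ b ] ∃[ c ] IsTriangle G a b c) ×
  Critical G k ×
  (∀ a b c → IsTriangle G a b c → ∀ m →
     ChromaticNumberIs G (Minus3 G a b c) m → m Data.Nat.+ 3 ≡ k)

IsoComplete : Graph → ℕ → Set
IsoComplete G m =
  Σ (Fin (n G) ↔ Fin m) λ f →
    ∀ u v → (Adj G u v → Inverse.to f u ≢ Inverse.to f v) ×
            (Inverse.to f u ≢ Inverse.to f v → Adj G u v)

{-# OPTIONS --safe #-}
module Submission where

-- Suppose G is not complete. By criticality every clique has at most 7 vertices. For a triangle
-- x v w, each class of a 5-colouring of G − {x, v, w} contains a common neighbour of x, v and w:
-- otherwise the class could be distributed over the classes of x, v, w, giving 7 colours in total.
-- Fix x in a triangle, let V = N(x), and for v ∈ V let N v be the neighbours and M v the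
-- non-neighbours (including v itself) of v in V. Every class meets V in at most two vertices, as G
-- is claw-free, so |V| ≤ 12, and adjacent v, w ∈ V have at least 5 common neighbours in V.
-- The latter gives |N v| ≥ 7, since otherwise v and N v form a 7-clique in V. If u ∈ V has a
-- non-neighbour y ∈ V, then the class of u yields a non-neighbour of u adjacent to y, and in turn a
-- further one, so |M u| ≥ 4. Hence |V| ∈ {11, 12} unless V is a clique. Counting the non-adjacent
-- pairs between N v and M v excludes |V| = 12, where every vertex of V has a non-neighbour in V,
-- and yields a 7-clique in V when |V| = 11.

open import Defs

open import Level using (0ℓ)
open import Data.Bool using () renaming (_≟_ to _≟ᵇ_)
open import Data.Nat hiding (_≟_)
open import Data.Nat.Properties hiding (_≟_)
open import Data.Nat.Induction using (<-rec)
open import Data.Fin using (Fin; zero; suc; punchOut; join; splitAt; _≟_)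
open import Data.Fin.Properties using (any?; injective⇒≤; punchOut-injective; splitAt-join)
open import Data.Vec using ([]; _∷_; lookup)
open import Data.Product using (∃; _×_; _,_; _,′_; proj₁; proj₂)
open import Data.Sum using (_⊎_; inj₁; inj₂)
open import Data.Sum.Properties using (inj₂-injective)
open import Data.Unit using (tt)
open import Data.Empty using (⊥)
open import Function using (_∘_; id; flip; case_of_)
open import Function.Construct.Identity using (↔-id)
open import Relation.Nullary using (¬_; Dec; yes; no; contradiction)
open import Relation.Nullary.Decidable using (decidable-stable; from-no; _×-dec_; ¬?)
open import Relation.Unary using (Pred; Decidable; _∩_; _∪_; ∁; _⊆_)
open import Relation.Unary.Properties using (_∩?_; _∪?_; ∁?)
open import Relation.Binary.PropositionalEquality
  using (_≡_; _≢_; refl; cong; cong₂; subst; trans; ≢-sym; module ≡-Reasoning) renaming (sym to ≡-sym)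
open import Algebra.Properties.CommutativeMonoid.Sum +-0-commutativeMonoid
  using (sum; ∑-comm; ∑-distrib-+; sum-cong-≗)

private variable
  k m : ℕ
  A B : Set

-- Counting in finite sets

sum-mono : {f g : Fin k → ℕ} → (∀ i → f i ≤ g i) → sum f ≤ sum g
sum-mono {zero}  f≤g = z≤n
sum-mono {suc _} f≤g = +-mono-≤ (f≤g zero) (sum-mono (f≤g ∘ suc))

sum-≤ : {f : Fin k → ℕ} → (∀ i → f i ≤ m) → sum f ≤ k * m
sum-≤ {zero}  f≤m = z≤n
sum-≤ {suc _} f≤m = +-mono-≤ (f≤m zero) (sum-≤ (f≤m ∘ suc))

sum-≥ : {f : Fin k → ℕ} → (∀ i → m ≤ f i) → k * m ≤ sum f
sum-≥ {zero}  m≤f = z≤n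
sum-≥ {suc _} m≤f = +-mono-≤ (m≤f zero) (sum-≥ (m≤f ∘ suc))

sum-*ʳ : (f : Fin k → ℕ) → ∀ m → sum (λ i → f i * m) ≡ sum f * m
sum-*ʳ {zero}  f m = refl
sum-*ʳ {suc _} f m = trans (cong (f zero * m +_) (sum-*ʳ (f ∘ suc) m)) (≡-sym (*-distribʳ-+ m (f zero) _))

sum-*ˡ : ∀ m → (f : Fin k → ℕ) → sum (λ i → m * f i) ≡ m * sum f
sum-*ˡ m f = trans (sum-cong-≗ (λ i → *-comm m (f i))) (trans (sum-*ʳ f m) (*-comm (sum f) m))

ind : Dec A → ℕ
ind (yes _) = 1
ind (no _)  = 0

ind-mono : (a? : Dec A) (b? : Dec B) → (A → B) → ind a? ≤ ind b?
ind-mono (yes a) (yes b) f = ≤-refl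
ind-mono (yes a) (no ¬b) f = contradiction (f a) ¬b
ind-mono (no ¬a) b?      f = z≤n

ind-× : (a? : Dec A) (b? : Dec B) → ind (a? ×-dec b?) ≡ ind a? * ind b?
ind-× (yes a) (yes b) = refl
ind-× (yes a) (no ¬b) = refl
ind-× (no ¬a) b?      = refl

ind-split : (a? : Dec A) (b? : Dec B) → ind a? ≡ ind (a? ×-dec b?) + ind (a? ×-dec ¬? b?)
ind-split (yes a) (yes b) = refl
ind-split (yes a) (no ¬b) = refl
ind-split (no ¬a) b?      = refl

private variable
  P Q : Pred (Fin k) 0ℓ

#_ : Decidable P → ℕ
# P? = sum (λ u → ind (P? u))

#-mono : (P? : Decidable P) (Q? : Decidable Q) → P ⊆ Q → # P? ≤ # Q?
#-mono P? Q? P⊆Q = sum-mono λ u → ind-mono (P? u) (Q? u) P⊆Q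

#-split : (P? : Decidable P) (Q? : Decidable Q) → # P? ≡ # (P? ∩? Q?) + # (P? ∩? ∁? Q?)
#-split P? Q? = trans (sum-cong-≗ (λ u → ind-split (P? u) (Q? u))) (∑-distrib-+ (λ u → ind ((P? ∩? Q?) u)) _)

#-zero : (P? : Decidable P) → (∀ u → ¬ P u) → # P? ≡ 0
#-zero {k} P? ¬P = n≤0⇒n≡0 (subst (# P? ≤_) (*-zeroʳ k) (sum-≤ λ u → ind-mono (P? u) (no id) (¬P u)))

#-singleton : (v : Fin k) → # (v ≟_) ≡ 1
#-singleton {suc k} zero    = cong suc (#-zero (λ (u : Fin k) → zero ≟ suc u) (λ _ ()))
#-singleton {suc k} (suc v) = trans
  (≤-antisym (sum-mono λ u → ind-mono (suc v ≟ suc u) (v ≟ u) λ { refl → refl })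
             (sum-mono λ u → ind-mono (v ≟ u) (suc v ≟ suc u) (cong suc)))
  (#-singleton v)

_∖_ : Decidable P → (v : Fin k) → Decidable (P ∩ ∁ (v ≡_))
P? ∖ v = P? ∩? ∁? (v ≟_)

#-remove : (P? : Decidable P) (v : Fin k) → P v → # P? ≡ suc (# (P? ∖ v))
#-remove P? v Pv = trans (#-split P? (v ≟_)) (cong (_+ # (P? ∖ v)) (trans
  (≤-antisym (#-mono (P? ∩? (v ≟_)) (v ≟_) proj₂)
             (#-mono (v ≟_) (P? ∩? (v ≟_)) λ { refl → Pv , refl }))
  (#-singleton v)))

#-≥ : (P? : Decidable P) {v : Fin k} → P v → m ≤ # (P? ∖ v) → suc m ≤ # P?
#-≥ P? {v} Pv m≤ = subst (_ ≤_) (≡-sym (#-remove P? v Pv)) (s≤s m≤)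

#-remove-≤ : (P? : Decidable P) (v : Fin k) → # P? ≤ suc (# (P? ∖ v))
#-remove-≤ P? v with P? v
... | yes Pv = ≤-reflexive (#-remove P? v Pv)
... | no ¬Pv = m≤n⇒m≤1+n (#-mono P? (P? ∖ v) λ Pu → Pu , λ { refl → ¬Pv Pu })

#-∃ : (P? : Decidable P) → 0 < # P? → ∃ P
#-∃ P? 0<#P with any? P?
... | yes ∃P = ∃P
... | no ¬∃P = contradiction (subst (0 <_) (#-zero P? (λ u Pu → ¬∃P (u , Pu))) 0<#P) (λ ())

#-≤1 : (P? : Decidable P) → (∀ {u v} → P u → P v → ¬ u ≢ v) → # P? ≤ 1
#-≤1 P? ≤1 = ≮⇒≥ λ 1<# → case #-∃ P? (<-trans z<s 1<#) of λ { (u , Pu) →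
  case #-∃ (P? ∖ u) (s≤s⁻¹ (subst (1 <_) (#-remove P? u Pu) 1<#)) of λ { (v , Pv , u≢v) → ≤1 Pu Pv u≢v } }

#-≤2 : (P? : Decidable P) → (∀ {u v w} → P u → P v → P w → u ≢ v → u ≢ w → ¬ v ≢ w) → # P? ≤ 2
#-≤2 P? ≤2 with any? P?
... | no ¬∃P = ≤-trans (≤-reflexive (#-zero P? (λ u Pu → ¬∃P (u , Pu)))) z≤n
... | yes (u , Pu) = ≤-trans (≤-reflexive (#-remove P? u Pu))
  (s≤s (#-≤1 (P? ∖ u) λ (Pv , u≢v) (Pw , u≢w) → ≤2 Pu Pv Pw u≢v u≢w))

#-fibres : (P? : Decidable P) (c : Fin k → Fin m) → # P? ≡ sum (λ i → # (P? ∩? λ u → c u ≟ i))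
#-fibres {k} {_} {m} P? c = ≡-sym (trans (∑-comm (λ i u → ind ((P? ∩? λ v → c v ≟ i) u))) (sum-cong-≗ λ u → begin
  sum (λ i → ind (P? u ×-dec c u ≟ i))   ≡⟨ sum-cong-≗ (λ i → ind-× (P? u) (c u ≟ i)) ⟩
  sum (λ i → ind (P? u) * ind (c u ≟ i)) ≡⟨ sum-*ˡ (ind (P? u)) (λ i → ind (c u ≟ i)) ⟩
  ind (P? u) * # (c u ≟_)                ≡⟨ cong (ind (P? u) *_) (#-singleton (c u)) ⟩
  ind (P? u) * 1                         ≡⟨ *-identityʳ _ ⟩
  ind (P? u)                             ∎))
  where open ≡-Reasoning

-- Both sides bound the number of pairs in `R` between `P` and `Q`, counted by rows on the left and
-- by columns on the right.
double-count : ∀ {k} {P Q : Pred (Fin k) 0ℓ} {R : Fin k → Fin k → Set}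
  (P? : Decidable P) (Q? : Decidable Q) (R? : ∀ u v → Dec (R u v)) (a b : ℕ) →
  (∀ {u} → P u → a ≤ # (Q? ∩? R? u)) → (∀ {v} → Q v → # (P? ∩? flip R? v) ≤ b) → # P? * a ≤ # Q? * b
double-count {k} P? Q? R? a b lower upper = begin
  # P? * a
    ≡⟨ ≡-sym (sum-*ʳ (λ u → ind (P? u)) a) ⟩
  sum (λ u → ind (P? u) * a)
    ≤⟨ sum-mono (λ u → low u (P? u)) ⟩
  sum (λ u → sum λ v → ind (P? u) * ind ((Q? ∩? R? u) v))
    ≡⟨ ∑-comm (λ u v → ind (P? u) * ind ((Q? ∩? R? u) v)) ⟩
  sum (λ v → sum λ u → ind (P? u) * ind ((Q? ∩? R? u) v))
    ≡⟨ sum-cong-≗ (λ v → sum-cong-≗ λ u → swap u v) ⟩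
  sum (λ v → sum λ u → ind (Q? v) * ind ((P? ∩? flip R? v) u))
    ≤⟨ sum-mono (λ v → upp v (Q? v)) ⟩
  sum (λ v → ind (Q? v) * b)
    ≡⟨ sum-*ʳ (λ v → ind (Q? v)) b ⟩
  # Q? * b ∎
  where
  open ≤-Reasoning
  low : ∀ u → (p? : Dec _) → ind p? * a ≤ sum λ v → ind p? * ind ((Q? ∩? R? u) v)
  low u (no _)   = z≤n
  low u (yes Pu) = ≤-trans (*-monoʳ-≤ 1 (lower Pu)) (≤-reflexive (≡-sym (sum-*ˡ {k} 1 _)))
  upp : ∀ v → (q? : Dec _) → (sum λ u → ind q? * ind ((P? ∩? flip R? v) u)) ≤ ind q? * b
  upp v (no ¬Qv) = ≤-reflexive (sum-*ˡ 0 (λ u → ind ((P? ∩? flip R? v) u)))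
  upp v (yes Qv) = ≤-trans (≤-reflexive (sum-*ˡ {k} 1 _)) (*-monoʳ-≤ 1 (upper Qv))
  swap : ∀ u v → ind (P? u) * ind ((Q? ∩? R? u) v) ≡ ind (Q? v) * ind ((P? ∩? flip R? v) u)
  swap u v with P? u | Q? v | R? u v
  ... | yes _ | yes _ | yes _ = refl
  ... | yes _ | yes _ | no _  = refl
  ... | yes _ | no _  | _     = refl
  ... | no _  | yes _ | _     = refl
  ... | no _  | no _  | _     = refl

-- The colourings below exist only up to double negation; this still lets bounds on counts be
-- derived from them.
stable-≤ : ∀ {a b} → ¬ ¬ (a ≤ b) → a ≤ b
stable-≤ = decidable-stable (_ ≤? _)

-- `P` need not be decidable, so the minimum exists only up to double negation.
least : (P : ℕ → Set) → ∀ a → P a → ¬ ¬ (∃ λ m → P m × (∀ j → P j → m ≤ j))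
least P = <-rec _ λ a rec Pa ¬least → ¬least (a , Pa , λ j Pj → ≮⇒≥ λ j<a → rec j<a Pj ¬least)

-- Colourings

module _ (G : Graph) where

  adj? : ∀ u v → Dec (Adj G u v)
  adj? u v = adj G u v ≟ᵇ _

  Adj-sym : ∀ {u v} → Adj G u v → Adj G v u
  Adj-sym {u} {v} = trans (sym G v u)

  Adj-irrefl : ∀ {u} → ¬ Adj G u u
  Adj-irrefl {u} uu with trans (≡-sym uu) (irrefl G u)
  ... | ()

  Adj⇒≢ : ∀ {u v} → Adj G u v → u ≢ v
  Adj⇒≢ uv refl = Adj-irrefl uv

  Clique : Pred (Fin (n G)) 0ℓ → Set
  Clique P = ∀ {u v} → P u → P v → u ≢ v → Adj G u v

  -- The colouring restricts to `S`, so `S` has a chromatic number up to double negation, and `drop`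
  -- forces it to be `m`.
  colorable-removal : {S : VSet G} {a : ℕ} → Colorable G (All G) a → (k m : ℕ) →
    (∀ j → ChromaticNumberIs G S j → j + k ≡ m + k) → ¬ ¬ Colorable G S m
  colorable-removal {S} (c , proper) k m drop ¬col =
    least (Colorable G S) _ (c , λ u v _ _ → proper u v tt tt) λ (j , col , j-min) →
      ¬col (subst (Colorable G S) (+-cancelʳ-≡ k j m (drop j (col , j-min))) col)

  -- If a colour class i has no common neighbour of t₁, …, t_ℓ, then its vertices can be
  -- distributed over the classes of the t_j, which saves colour i.
  module _ {ℓ k : ℕ} (t : Fin ℓ → Fin (n G)) (c : Fin (n G) → Fin (suc k)) (i : Fin (suc k)) where

    Off : VSet G
    Off u = ∀ j → u ≢ t j

    data Slot (u : Fin (n G)) : Set where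
      host : ∀ j → u ≡ t j ⊎ (Off u × c u ≡ i × ¬ Adj G (t j) u) → Slot u
      keep : Off u → i ≢ c u → Slot u

    colour : ∀ {u} → Slot u → Fin ℓ ⊎ Fin k
    colour (host j _)   = inj₁ j
    colour (keep _ i≢c) = inj₂ (punchOut i≢c)

    colorable-extend : (∀ u v → Off u → Off v → Adj G u v → c u ≢ c v) →
      (∀ u → Off u → c u ≡ i → ∃ λ j → ¬ Adj G (t j) u) → Colorable G (All G) (ℓ + k)
    colorable-extend proper avoid =
      (λ u → join ℓ k (colour (slot u))) , λ u v _ _ uv eq → colour-proper uv (slot u) (slot v)
        (trans (≡-sym (splitAt-join ℓ k _)) (trans (cong (splitAt ℓ) eq) (splitAt-join ℓ k _)))
      where
      slot : ∀ u → Slot u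
      slot u with any? (λ j → u ≟ t j) | i ≟ c u
      ... | yes (j , u≡tj) | _       = host j (inj₁ u≡tj)
      ... | no ¬t          | no i≢c  = keep (λ j u≡tj → ¬t (j , u≡tj)) i≢c
      ... | no ¬t          | yes i≡c = let off = λ j u≡tj → ¬t (j , u≡tj)
                                           j , ¬tu = avoid u off (≡-sym i≡c)
                                       in host j (inj₂ (off , ≡-sym i≡c , ¬tu))

      colour-proper : ∀ {u v} → Adj G u v → (p : Slot u) (q : Slot v) → colour p ≢ colour q
      colour-proper uv (host j (inj₁ refl)) (host _ (inj₁ refl)) refl = Adj-irrefl uv
      colour-proper uv (host j (inj₁ refl)) (host _ (inj₂ (_ , _ , ¬tv))) refl = ¬tv uv
      colour-proper uv (host j (inj₂ (_ , _ , ¬tu))) (host _ (inj₁ refl)) refl = ¬tu (Adj-sym uv)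
      colour-proper uv (host j (inj₂ (u-off , cu , _))) (host _ (inj₂ (v-off , cv , _))) refl =
        proper _ _ u-off v-off uv (trans cu (≡-sym cv))
      colour-proper uv (keep u-off i≢cu) (keep v-off i≢cv) eq =
        proper _ _ u-off v-off uv (punchOut-injective i≢cu i≢cv (inj₂-injective eq))

  -- `col` is unconstrained at `x`, `y`, `z`. The vertex in `meets` differs from them, being
  -- adjacent to all three.
  record Rainbow (k : ℕ) (x y z : Fin (n G)) : Set where
    field
      col    : Fin (n G) → Fin k
      proper : ∀ {u v} → Minus3 G x y z u → Minus3 G x y z v → Adj G u v → col u ≢ col v
      meets  : ∀ i → ∃ λ w → Adj G x w × Adj G y w × Adj G z w × col w ≡ i

  triangle-rainbow : TriangleCritical G (5 + 3) → ∀ {x y z} → IsTriangle G x y z → ¬ ¬ Rainbow 5 x y z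
  triangle-rainbow (_ , ((col₈ , min₈) , _) , drop) {x} {y} {z} tri ¬r =
    colorable-removal col₈ 3 5 (drop x y z tri) λ (c , proper) → ¬r record
      { col    = c
      ; proper = λ u-off v-off → proper _ _ u-off v-off
      ; meets  = λ i → decidable-stable (any? λ w → adj? x w ×-dec adj? y w ×-dec adj? z w ×-dec c w ≟ i)
          -- A class without a common neighbour would leave 3 host colours and 4 kept ones, one
          -- fewer than the chromatic number.
          λ ¬meets → contradiction (min₈ 7 (colorable-extend t c i
            (λ u v u-off v-off → proper u v (off₃ u-off) (off₃ v-off))
            (λ u u-off cu → avoid u (λ (xu , yu , zu) → ¬meets (u , xu , yu , zu , cu)))))
            1+n≰n
      }
    where
    t : Fin 3 → Fin (n G)
    t = lookup (x ∷ y ∷ z ∷ [])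
    off₃ : ∀ {u} → (∀ j → u ≢ t j) → Minus3 G x y z u
    off₃ off = off zero , off (suc zero) , off (suc (suc zero))
    avoid : ∀ u → ¬ (Adj G x u × Adj G y u × Adj G z u) → ∃ λ j → ¬ Adj G (t j) u
    avoid u ¬common with adj? x u | adj? y u | adj? z u
    ... | no ¬xu | _      | _      = zero , ¬xu
    ... | yes _  | no ¬yu | _      = suc zero , ¬yu
    ... | yes _  | yes _  | no ¬zu = suc (suc zero) , ¬zu
    ... | yes xu | yes yu | yes zu = contradiction (xu , yu , zu) ¬common

  -- Without `v` the graph has a `k`-colouring, and each class contains at most one vertex of the
  -- clique.
  clique-bound : ∀ {k} → Critical G (k + 1) → {P : Pred (Fin (n G)) 0ℓ} (P? : Decidable P) → Clique P →
    ∀ {v} → ¬ P v → # P? ≤ k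
  clique-bound {k} ((col , _) , drop) P? clique {v} ¬Pv = stable-≤ λ ≰k →
    colorable-removal col 1 k (drop v) λ (c , proper) → ≰k (begin
      # P?
        ≡⟨ #-fibres P? c ⟩
      sum (λ i → # (P? ∩? λ u → c u ≟ i))
        ≤⟨ sum-≤ (λ i → #-≤1 (P? ∩? λ u → c u ≟ i) λ (Pu , cu) (Pw , cw) u≢w →
             proper _ _ (λ { refl → ¬Pv Pu }) (λ { refl → ¬Pv Pw }) (clique Pu Pw u≢w)
               (trans cu (≡-sym cw))) ⟩
      k * 1
        ≡⟨ *-identityʳ k ⟩
      k ∎)
    where open ≤-Reasoning

-- The neighbourhood of a vertex

module Neighbourhood (G : Graph) (claw-free : ClawFree G)
  (clique≤7 : {P : Pred (Fin (n G)) 0ℓ} (P? : Decidable P) → Clique G P → # P? ≤ 7)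
  (rainbow : ∀ {x y z} → IsTriangle G x y z → ¬ ¬ Rainbow G 5 x y z)
  (x y₀ z₀ : Fin (n G)) (tri₀ : IsTriangle G x y₀ z₀) where

  private
    _~_ : Fin (n G) → Fin (n G) → Set
    _~_ = Adj G

    ~-sym : ∀ {u v} → u ~ v → v ~ u
    ~-sym = Adj-sym G

    ~⇒≢ : ∀ {u v} → u ~ v → u ≢ v
    ~⇒≢ = Adj⇒≢ G

    V : Pred (Fin (n G)) 0ℓ
    V = x ~_

    V? : Decidable V
    V? = adj? G x

    N M : Fin (n G) → Pred (Fin (n G)) 0ℓ
    N v = V ∩ (v ~_)
    M v = V ∩ ∁ (v ~_)

    N? : ∀ v → Decidable (N v)
    N? v = V? ∩? adj? G v

    M? : ∀ v → Decidable (M v)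
    M? v = V? ∩? ∁? (adj? G v)

    C? : ∀ v w → Decidable (V ∩ ((v ~_) ∩ (w ~_)))
    C? v w = V? ∩? adj? G v ∩? adj? G w

    V-split : ∀ v → # V? ≡ # N? v + # M? v
    V-split v = #-split V? (adj? G v)

    V-y₀ : V y₀
    V-y₀ = proj₁ tri₀

    V-z₀ : V z₀
    V-z₀ = proj₂ (proj₂ tri₀)

    y₀~z₀ : y₀ ~ z₀
    y₀~z₀ = proj₁ (proj₂ tri₀)

  -- Cliques and colour classes in `V`

  no-claw : ∀ {u v w} → V u → V v → V w → u ≢ v → u ≢ w → v ≢ w → ¬ u ~ v → ¬ u ~ w → ¬ ¬ v ~ w
  no-claw Vu Vv Vw u≢v u≢w v≢w ¬uv ¬uw ¬vw =
    claw-free x _ _ _ (Vu , Vv , Vw , u≢v , u≢w , v≢w , ¬uv , ¬uw , ¬vw)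

  module _ {P : Pred (Fin (n G)) 0ℓ} (P? : Decidable P) (P⊆V : P ⊆ V) (clique : Clique G P) where

    clique-in-V : # P? ≤ 6
    clique-in-V = s≤s⁻¹ (≤-trans
      (#-≥ P⁺? (inj₁ refl) (#-mono P? (P⁺? ∖ x) λ Pu → inj₂ Pu , ~⇒≢ (P⊆V Pu)))
      (clique≤7 P⁺? clique⁺))
      where
      P⁺? : Decidable ((x ≡_) ∪ P)
      P⁺? = (x ≟_) ∪? P?
      clique⁺ : Clique G ((x ≡_) ∪ P)
      clique⁺ (inj₁ refl) (inj₁ refl) u≢v = contradiction refl u≢v
      clique⁺ (inj₁ refl) (inj₂ Pv)   u≢v = P⊆V Pv
      clique⁺ (inj₂ Pu)   (inj₁ refl) u≢v = ~-sym (P⊆V Pu)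
      clique⁺ (inj₂ Pu)   (inj₂ Pv)   u≢v = clique Pu Pv u≢v

  common≥5 : ∀ {y z} → V y → V z → y ~ z → 5 ≤ # C? y z
  common≥5 {y} {z} Vy Vz yz = stable-≤ λ ≱5 → rainbow (Vy , yz , Vz) λ r → let open Rainbow r in ≱5 (begin
    5 * 1
      ≤⟨ sum-≥ (λ i → let w , xw , yw , zw , cw = meets i in
           #-≥ (C? y z ∩? λ u → col u ≟ i) ((xw , yw , zw) , cw) z≤n) ⟩
    sum (λ i → # (C? y z ∩? λ u → col u ≟ i))
      ≡⟨ ≡-sym (#-fibres (C? y z) col) ⟩
    # C? y z ∎)
    where open ≤-Reasoning

  module _ {y z} (r : Rainbow G 5 x y z) where
    open Rainbow r

    Rest : Pred (Fin (n G)) 0ℓ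
    Rest = (V ∩ ∁ (y ≡_)) ∩ ∁ (z ≡_)

    Rest? : Decidable Rest
    Rest? = (V? ∖ y) ∖ z

    V≤rest : # V? ≤ 2 + # Rest?
    V≤rest = ≤-trans (#-remove-≤ V? y) (s≤s (#-remove-≤ (V? ∖ y) z))

    rest-nonadj : ∀ {u v i} → (Rest u × col u ≡ i) → (Rest v × col v ≡ i) → ¬ u ~ v
    rest-nonadj (((Vu , y≢u) , z≢u) , cu) (((Vv , y≢v) , z≢v) , cv) uv =
      proper (≢-sym (~⇒≢ Vu) , ≢-sym y≢u , ≢-sym z≢u) (≢-sym (~⇒≢ Vv) , ≢-sym y≢v , ≢-sym z≢v) uv
        (trans cu (≡-sym cv))

    Rest⊆V : Rest ⊆ V
    Rest⊆V = proj₁ ∘ proj₁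

    -- Three vertices of one class would be pairwise non-adjacent and form a claw with centre `x`.
    rest-class : ∀ i → # (Rest? ∩? λ u → col u ≟ i) ≤ 2
    rest-class i = #-≤2 (Rest? ∩? λ u → col u ≟ i) λ Pu Pv Pw u≢v u≢w v≢w →
      no-claw (Rest⊆V (proj₁ Pu)) (Rest⊆V (proj₁ Pv)) (Rest⊆V (proj₁ Pw)) u≢v u≢w v≢w
        (rest-nonadj Pu Pv) (rest-nonadj Pu Pw) (rest-nonadj Pv Pw)

  V≤12 : # V? ≤ 12
  V≤12 = stable-≤ λ ≰12 → rainbow tri₀ λ r → let open Rainbow r in
    -- Two for `y₀` and `z₀`, and at most two for each of the five classes.
    ≰12 (≤-trans (V≤rest r) (+-monoʳ-≤ 2
      (≤-trans (≤-reflexive (#-fibres (Rest? r) col)) (sum-≤ (rest-class r)))))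

  -- A vertex w adjacent to all of V is alone in its colour class.
  dominating⇒V≤11 : ∀ {w y z} → V w → V y → V z → y ~ z → w ≢ y → w ≢ z →
    (∀ {u} → V u → u ≢ w → u ~ w) → # V? ≤ 11
  dominating⇒V≤11 {w} {y} {z} Vw Vy Vz yz w≢y w≢z dom = stable-≤ λ ≰11 → rainbow (Vy , yz , Vz) λ r →
    let open Rainbow r
        class? = λ i → Rest? r ∩? λ u → col u ≟ i
        w-class : # class? (col w) ≤ 1
        w-class = ≤-trans (#-remove-≤ (class? (col w)) w) (s≤s (≤-reflexive (#-zero (class? (col w) ∖ w)
          λ u (Pu , w≢u) → rest-nonadj r Pu (((Vw , ≢-sym w≢y) , ≢-sym w≢z) , refl)
            (dom (Rest⊆V r (proj₁ Pu)) (≢-sym w≢u)))))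
        -- One extra in the class of `w` keeps the bound 2 for every class, so `Rest` has at most 9
        -- vertices.
        class-bound : ∀ i → # class? i + ind (col w ≟ i) ≤ 2
        class-bound i = case col w ≟ i of λ where
          (yes refl) → +-mono-≤ w-class (ind-mono (col w ≟ col w) (yes tt) _)
          (no ≢i)    → +-mono-≤ (rest-class r i) (ind-mono (col w ≟ i) (no id) ≢i)
    in ≰11 (≤-trans (V≤rest r) (+-monoʳ-≤ 2 (s≤s⁻¹ (begin
      suc (# Rest? r)
        ≡⟨ +-comm 1 _ ⟩
      # Rest? r + 1
        ≡⟨ cong₂ _+_ (#-fibres (Rest? r) col) (≡-sym (#-singleton (col w))) ⟩
      sum (λ i → # class? i) + # (col w ≟_)
        ≡⟨ ≡-sym (∑-distrib-+ (λ i → # class? i) (λ i → ind (col w ≟ i))) ⟩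
      sum (λ i → # class? i + ind (col w ≟ i))
        ≤⟨ sum-≤ class-bound ⟩
      10 ∎))))
    where open ≤-Reasoning

  -- The class of `u` contains a common neighbour `w` of `x`, `y` and `z`. Sharing a colour, `u` and
  -- `w` are not adjacent; they differ because only `w` is adjacent to `y`.
  nonneighbour-step : ∀ {u y z} → V u → V y → V z → y ~ z → u ≢ y → ¬ u ~ y → u ≢ z →
    ¬ ¬ (∃ λ w → V w × y ~ w × z ~ w × u ≢ w × ¬ u ~ w)
  nonneighbour-step {u} Vu Vy Vz yz u≢y ¬uy u≢z ¬∃ = rainbow (Vy , yz , Vz) λ r → let open Rainbow r in
    case meets (col u) of λ (w , Vw , yw , zw , cw) →
      ¬∃ (w , Vw , yw , zw , (λ { refl → ¬uy (~-sym yw) }) , λ uw →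
        proper (≢-sym (~⇒≢ Vu) , u≢y , u≢z) (≢-sym (~⇒≢ Vw) , ≢-sym (~⇒≢ yw) , ≢-sym (~⇒≢ zw)) uw (≡-sym cw))

  -- If `v` had no neighbour in `V`, claw-freeness would make the rest of `V` a clique; yet it
  -- contains `y₀`, `z₀` and their five common neighbours.
  neighbour-in-V : ∀ {v} → V v → ∃ (N v)
  neighbour-in-V {v} Vv with any? (N? v)
  ... | yes ∃N = ∃N
  ... | no ¬∃N = contradiction (≤-trans 7≤ (clique-in-V (V? ∖ v) proj₁ clique)) 1+n≰n
    where
    clique : Clique G (V ∩ ∁ (v ≡_))
    clique (Vu , v≢u) (Vw , v≢w) u≢w = decidable-stable (adj? G _ _)
      (no-claw Vv Vu Vw v≢u v≢w u≢w (λ vu → ¬∃N (_ , Vu , vu)) (λ vw → ¬∃N (_ , Vw , vw)))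
    7≤ : 7 ≤ # (V? ∖ v)
    7≤ = #-≥ (V? ∖ v) (V-y₀ , λ { refl → ¬∃N (z₀ , V-z₀ , y₀~z₀) })
        (#-≥ ((V? ∖ v) ∖ y₀) ((V-z₀ , λ { refl → ¬∃N (y₀ , V-y₀ , ~-sym y₀~z₀) }) , ~⇒≢ y₀~z₀)
        (≤-trans (common≥5 V-y₀ V-z₀ y₀~z₀) (#-mono (C? y₀ z₀) (((V? ∖ v) ∖ y₀) ∖ z₀)
          λ (Vu , yu , zu) → ((Vu , λ { refl → ¬∃N (y₀ , V-y₀ , ~-sym yu) }) , ~⇒≢ yu) , ~⇒≢ zu)))

  -- With at most 6 members `N v` is a clique: non-adjacent `u` and `w` in it, with the five common
  -- neighbours of `v` and `u`, would make seven. It has at least 6, a neighbour `z` and the common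
  -- neighbours of `v` and `z`, so `v` completes a 7-clique in `V`.
  N≥7 : ∀ {v} → V v → 7 ≤ # N? v
  N≥7 {v} Vv = stable-≤ λ ≱7 →
    let z , Vz , vz = neighbour-in-V Vv
        6≤ : 6 ≤ # N? v
        6≤ = #-≥ (N? v) (Vz , vz) (≤-trans (common≥5 Vv Vz vz)
          (#-mono (C? v z) (N? v ∖ z) λ (Vu , vu , zu) → (Vu , vu) , ~⇒≢ zu))
        clique : Clique G (N v)
        clique = λ {u} {w} (Vu , vu) (Vw , vw) u≢w → decidable-stable (adj? G u w) λ ¬uw →
          ≱7 (#-≥ (N? v) (Vu , vu) (#-≥ (N? v ∖ u) ((Vw , vw) , u≢w) (≤-trans (common≥5 Vv Vu vu)
            (#-mono (C? v u) ((N? v ∖ u) ∖ w) λ (Vt , vt , ut) → ((Vt , vt) , ~⇒≢ ut) , λ { refl → ¬uw ut }))))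
        N⁺? : Decidable ((v ≡_) ∪ N v)
        N⁺? = (v ≟_) ∪? N? v
        clique⁺ : Clique G ((v ≡_) ∪ N v)
        clique⁺ = λ where
          (inj₁ refl) (inj₁ refl) u≢w → contradiction refl u≢w
          (inj₁ refl) (inj₂ Nw)   u≢w → proj₂ Nw
          (inj₂ Nu)   (inj₁ refl) u≢w → ~-sym (proj₂ Nu)
          (inj₂ Nu)   (inj₂ Nw)   u≢w → clique Nu Nw u≢w
    in contradiction
      (≤-trans (#-≥ N⁺? (inj₁ refl)
                 (≤-trans 6≤ (#-mono (N? v) (N⁺? ∖ v) λ Nu → inj₂ Nu , ~⇒≢ (proj₂ Nu))))
               (clique-in-V N⁺? (λ { (inj₁ refl) → Vv ; (inj₂ Nu) → proj₁ Nu }) clique⁺))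
      1+n≰n

  -- The four members are `u`, `y`, and two from `nonneighbour-step`: `w` from the pair `y`, `z`,
  -- then `w′` from the pair `y`, `w`.
  M≥4 : ∀ {u y} → V u → V y → u ≢ y → ¬ u ~ y → 4 ≤ # M? u
  M≥4 {u} {y} Vu Vy u≢y ¬uy = stable-≤ λ ≱4 →
    let z , Vz , yz = neighbour-in-V Vy in
    nonneighbour-step Vu Vy Vz yz u≢y ¬uy (λ { refl → ¬uy (~-sym yz) }) λ (w , Vw , yw , _ , u≢w , ¬uw) →
    nonneighbour-step Vu Vy Vw yw u≢y ¬uy u≢w λ (w′ , Vw′ , yw′ , ww′ , u≢w′ , ¬uw′) →
    ≱4 (#-≥ (M? u) (Vu , Adj-irrefl G)
       (#-≥ (M? u ∖ u) ((Vy , ¬uy) , u≢y)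
       (#-≥ ((M? u ∖ u) ∖ y) (((Vw , ¬uw) , u≢w) , ~⇒≢ yw)
       (#-≥ (((M? u ∖ u) ∖ y) ∖ w) ((((Vw′ , ¬uw′) , u≢w′) , ~⇒≢ yw′) , ~⇒≢ ww′) z≤n))))

  -- Non-adjacent pairs in `V`

  M≱4⇒dominating : ∀ {w} → V w → ¬ 4 ≤ # M? w → ∀ {u} → V u → u ≢ w → u ~ w
  M≱4⇒dominating Vw ≱4 Vu u≢w = decidable-stable (adj? G _ _) λ ¬uw →
    ≱4 (M≥4 Vw Vu (≢-sym u≢w) (¬uw ∘ ~-sym))

  -- Since `u` itself lies in `M u`, `M≥4` makes the bound equivalent to `u` having another
  -- non-neighbour in `V`.
  D : Fin (n G) → Pred (Fin (n G)) 0ℓ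
  D v = N v ∩ (λ u → 4 ≤ # M? u)

  D? : ∀ v → Decidable (D v)
  D? v = N? v ∩? λ u → 4 ≤? # M? u

  M-remove : ∀ {v} → V v → # M? v ≡ suc (# (M? v ∖ v))
  M-remove {v} Vv = #-remove (M? v) v (Vv , Adj-irrefl G)

  -- Double counting of the non-adjacent pairs between D v and M v ∖ v. Each w ∈ D v has at most
  -- # N? v − 5 non-neighbours in N v, which leaves at least 4 − (# N? v − 5) outside N v.
  nonadjacent-pairs : ∀ {v} m → V v → (∀ {u} → V u → # M? u ≤ 2 + m) →
    # D? v * (9 ∸ # N? v) ≤ # (M? v ∖ v) * m
  nonadjacent-pairs {v} m Vv M≤ = double-count (D? v) (M? v ∖ v) (λ w u → ¬? (adj? G w u)) _ m lower upper
    where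
    open ≤-Reasoning
    lower : ∀ {w} → D v w → 9 ∸ # N? v ≤ # ((M? v ∖ v) ∩? λ u → ¬? (adj? G w u))
    lower {w} ((Vw , vw) , 4≤Mw) = m≤n+o⇒m∸n≤o 9 (# N? v) (begin
      5 + 4                          ≤⟨ +-monoʳ-≤ 5 4≤Mw ⟩
      5 + # M? w                     ≡⟨ cong (5 +_) (#-split (M? w) (adj? G v)) ⟩
      5 + (# (M? w ∩? adj? G v) + # (M? w ∩? ∁? (adj? G v)))
                                     ≤⟨ +-mono-≤ (common≥5 Vv Vw vw) (+-mono-≤ M∩N≤ M∖N≤) ⟩
      # C? v w + (# (N? v ∩? ∁? (adj? G w)) + rest)
                                     ≡⟨ ≡-sym (+-assoc (# C? v w) _ rest) ⟩
      # C? v w + # (N? v ∩? ∁? (adj? G w)) + rest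
                                     ≤⟨ +-monoˡ-≤ rest (+-monoˡ-≤ _ C≤) ⟩
      # (N? v ∩? adj? G w) + # (N? v ∩? ∁? (adj? G w)) + rest
                                     ≡⟨ cong (_+ rest) (≡-sym (#-split (N? v) (adj? G w))) ⟩
      # N? v + rest                  ∎)
      where
      rest = # ((M? v ∖ v) ∩? ∁? (adj? G w))
      M∩N≤ : # (M? w ∩? adj? G v) ≤ # (N? v ∩? ∁? (adj? G w))
      M∩N≤ = #-mono (M? w ∩? adj? G v) (N? v ∩? ∁? (adj? G w)) λ ((Vu , ¬wu) , vu) → (Vu , vu) , ¬wu
      M∖N≤ : # (M? w ∩? ∁? (adj? G v)) ≤ rest
      M∖N≤ = #-mono (M? w ∩? ∁? (adj? G v)) ((M? v ∖ v) ∩? ∁? (adj? G w))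
        λ ((Vu , ¬wu) , ¬vu) → ((Vu , ¬vu) , λ { refl → ¬wu (~-sym vw) }) , ¬wu
      C≤ : # C? v w ≤ # (N? v ∩? adj? G w)
      C≤ = #-mono (C? v w) (N? v ∩? adj? G w) λ (Vu , vu , wu) → (Vu , vu) , wu
    -- `M u` contains `u` and `v`, both outside `D v`.
    upper : ∀ {u} → (M v ∩ ∁ (v ≡_)) u → # (D? v ∩? λ w → ¬? (adj? G w u)) ≤ m
    upper {u} ((Vu , ¬vu) , v≢u) = s≤s⁻¹ (s≤s⁻¹ (≤-trans
      (#-≥ (M? u) (Vu , Adj-irrefl G) (#-≥ (M? u ∖ u) ((Vv , ¬vu ∘ ~-sym) , ≢-sym v≢u)
        (#-mono (D? v ∩? λ w → ¬? (adj? G w u)) ((M? u ∖ u) ∖ v)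
          λ (((Vw , vw) , _) , ¬wu) → ((Vw , ¬wu ∘ ~-sym) , λ { refl → ¬vu vw }) , ~⇒≢ vw)))
      (M≤ Vu)))

  M≤ : ∀ {u} m → V u → # V? ≤ 7 + m → # M? u ≤ m
  M≤ {u} m Vu V≤ = +-cancelˡ-≤ 7 _ m (≤-trans (+-monoˡ-≤ _ (N≥7 Vu)) (≤-trans (≤-reflexive (≡-sym (V-split u))) V≤))

  -- The cases of 12 and 11 neighbours

  module _ (V≡12 : # V? ≡ 12) where

    -- A neighbour `w` of `v` outside `D v` would be adjacent to all other vertices of `V`;
    -- `dominating⇒V≤11`, applied to `v` and another neighbour `z` of `v`, excludes this.
    N⊆D : ∀ {v} → V v → # N? v ≤ # D? v
    N⊆D {v} Vv = #-mono (N? v) (D? v) λ {w} (Vw , vw) → (Vw , vw) , stable-≤ λ ≱4 →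
      let z , (Vz , vz) , w≢z =
            #-∃ (N? v ∖ w) (≤-trans (s≤s z≤n) (s≤s⁻¹ (≤-trans (N≥7 Vv) (#-remove-≤ (N? v) w))))
      in 1+n≰n (subst (_≤ 11) V≡12
           (dominating⇒V≤11 Vw Vv Vz vz (≢-sym (~⇒≢ vw)) w≢z (M≱4⇒dominating Vw ≱4)))

    pairs₁₂ : ∀ {v} g b m → V v → # N? v ≡ g → # M? v ≡ suc b →
      (∀ {u} → V u → # M? u ≤ 2 + m) → g * (9 ∸ g) ≤ b * m
    pairs₁₂ {v} _ b m Vv refl Mv M≤m = begin
      # N? v * (9 ∸ # N? v) ≤⟨ *-monoˡ-≤ (9 ∸ # N? v) (N⊆D Vv) ⟩
      # D? v * (9 ∸ # N? v) ≤⟨ nonadjacent-pairs m Vv M≤m ⟩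
      # (M? v ∖ v) * m      ≡⟨ cong (_* m) (suc-injective (trans (≡-sym (M-remove Vv)) Mv)) ⟩
      b * m                 ∎
      where open ≤-Reasoning

    M≢5 : ∀ {v} → V v → # N? v ≡ 7 → # M? v ≢ 5
    -- At least `7 * 2` pairs against at most `4 * 3`; here `m` is 3 because `# M? u` is at most 12
    -- - 7 = 5.
    M≢5 Vv Nv Mv = from-no (14 ≤? 12) (pairs₁₂ 7 4 3 Vv Nv Mv λ Vu → M≤ 5 Vu (≤-reflexive V≡12))

    M≤4 : ∀ {v} → V v → # M? v ≤ 4
    M≤4 {v} Vv with m≤n⇒m<n∨m≡n (M≤ 5 Vv (≤-reflexive V≡12))
    ... | inj₁ <5 = s≤s⁻¹ <5
    ... | inj₂ ≡5 = contradiction ≡5 (M≢5 Vv (+-cancelʳ-≡ 5 _ 7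
      (trans (cong (# N? v +_) (≡-sym ≡5)) (trans (≡-sym (V-split v)) V≡12))))

    N≢8 : ∀ {v} → V v → # M? v ≡ 4 → # N? v ≢ 8
    -- The sharper `M≤4` allows `m` to be 2: `8 * 1` against `3 * 2`.
    N≢8 Vv Mv Nv = from-no (8 ≤? 6) (pairs₁₂ 8 3 2 Vv Nv Mv M≤4)

  -- Discarding `v` and the at most 3 vertices of `D v` leaves at least 7. If `u` and `w` among
  -- these were non-adjacent, `M≥4` would apply to both, so neither would be adjacent to `v`, giving
  -- a claw at `x`.
  V≢11 : ∀ {v} → V v → # N? v ≡ 7 → # M? v ≡ 4 → ⊥
  V≢11 {v} Vv Nv Mv = 1+n≰n (≤-trans 7≤K (clique-in-V K? (proj₁ ∘ proj₁) clique))
    where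
    open ≤-Reasoning
    V≡11 : # V? ≡ 11
    V≡11 = trans (V-split v) (cong₂ _+_ Nv Mv)
    K? : Decidable ((V ∩ ∁ (v ≡_)) ∩ ∁ (D v))
    K? = (V? ∖ v) ∩? ∁? (D? v)
    D≤3 : # D? v ≤ 3
    D≤3 = *-cancelʳ-≤ (# D? v) 3 2 (begin
      # D? v * 2            ≡⟨ cong (λ g → # D? v * (9 ∸ g)) (≡-sym Nv) ⟩
      # D? v * (9 ∸ # N? v) ≤⟨ nonadjacent-pairs 2 Vv (λ Vu → M≤ 4 Vu (≤-reflexive V≡11)) ⟩
      # (M? v ∖ v) * 2      ≡⟨ cong (_* 2) (suc-injective (trans (≡-sym (M-remove Vv)) Mv)) ⟩
      3 * 2                 ∎)
    7≤K : 7 ≤ # K?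
    7≤K = +-cancelˡ-≤ 3 7 _ (begin
      10                                ≡⟨ suc-injective (trans (≡-sym V≡11) (#-remove V? v Vv)) ⟩
      # (V? ∖ v)                        ≡⟨ #-split (V? ∖ v) (D? v) ⟩
      # ((V? ∖ v) ∩? D? v) + # K?       ≤⟨ +-monoˡ-≤ (# K?) (≤-trans (#-mono ((V? ∖ v) ∩? D? v) (D? v) proj₂) D≤3) ⟩
      3 + # K?                          ∎)
    clique : Clique G ((V ∩ ∁ (v ≡_)) ∩ ∁ (D v))
    clique ((Vu , v≢u) , ¬Du) ((Vw , v≢w) , ¬Dw) u≢w = decidable-stable (adj? G _ _) λ ¬uw →
      no-claw Vv Vu Vw v≢u v≢w u≢w
        (λ vu → ¬Du ((Vu , vu) , M≥4 Vu Vw u≢w ¬uw))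
        (λ vw → ¬Dw ((Vw , vw) , M≥4 Vw Vu (≢-sym u≢w) (¬uw ∘ ~-sym))) ¬uw

  -- As `V` has at most 12 vertices, the sizes of `N v` and `M v` could only be 7 and 4, 7 and 5, or
  -- 8 and 4.
  ¬M≥4 : ∀ {v} → V v → ¬ 4 ≤ # M? v
  ¬M≥4 {v} Vv 4≤M with m≤n⇒∃[o]m+o≡n (N≥7 Vv) | m≤n⇒∃[o]m+o≡n 4≤M
  ... | i , 7+i≡N | j , 4+j≡M =
    cases i j (i+j≤1 i j (≡-sym 7+i≡N) (≡-sym 4+j≡M)) (≡-sym 7+i≡N) (≡-sym 4+j≡M)
    where
    i+j≤1 : ∀ i j → # N? v ≡ 7 + i → # M? v ≡ 4 + j → i + j ≤ 1
    i+j≤1 i j Nv Mv = +-cancelˡ-≤ 11 _ 1 (begin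
      7 + (4 + (i + j))  ≡⟨ cong (7 +_) (trans (cong (4 +_) (+-comm i j)) (+-comm (4 + j) i)) ⟩
      7 + (i + (4 + j))  ≡⟨ ≡-sym (trans (V-split v) (cong₂ _+_ Nv Mv)) ⟩
      # V?               ≤⟨ V≤12 ⟩
      12                 ∎)
      where open ≤-Reasoning
    cases : ∀ i j → i + j ≤ 1 → # N? v ≡ 7 + i → # M? v ≡ 4 + j → ⊥
    cases zero          zero          _        Nv Mv = V≢11 Vv Nv Mv
    cases zero          (suc zero)    _        Nv Mv = M≢5 (trans (V-split v) (cong₂ _+_ Nv Mv)) Vv Nv Mv
    cases (suc zero)    zero          _        Nv Mv = N≢8 (trans (V-split v) (cong₂ _+_ Nv Mv)) Vv Mv Nv
    cases zero          (suc (suc _)) (s≤s ())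
    cases (suc zero)    (suc _)       (s≤s ())
    cases (suc (suc _)) _             (s≤s ())

  -- With no non-adjacent pair left, `V` is a clique of at most 6 vertices, though `N y₀` has at
  -- least 7.
  impossible : ⊥
  impossible = 1+n≰n (≤-trans (N≥7 V-y₀) (≤-trans (#-mono (N? y₀) V? proj₁)
    (clique-in-V V? id λ Vu Vv u≢v → M≱4⇒dominating Vv (¬M≥4 Vv) Vu u≢v)))

-- Completeness and order of the graph

complete : (G : Graph) → ClawFree G → TriangleCritical G 8 → ∀ u v → u ≢ v → Adj G u v
complete G claw-free tc@((x , y , z , tri) , crit , _) u v u≢v = decidable-stable (adj? G u v) λ ¬uv →
  Neighbourhood.impossible G claw-free
    -- A clique misses `u` or `v`, as these are not adjacent.
    (λ P? clique → case P? u ,′ P? v of λ where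
      (yes Pu , yes Pv) → contradiction (clique Pu Pv u≢v) ¬uv
      (no ¬Pu , _)      → clique-bound G crit P? clique ¬Pu
      (yes _  , no ¬Pv) → clique-bound G crit P? clique ¬Pv)
    (triangle-rainbow G tc) x y z tri

isoComplete : ∀ (G : Graph) {m} → n G ≡ m → (∀ u v → u ≢ v → Adj G u v) → IsoComplete G m
isoComplete G refl complete = ↔-id _ , λ u v → Adj⇒≢ G , complete u v

theorem10 : (G : Graph) → ClawFree G → TriangleCritical G 8 → IsoComplete G 8
theorem10 G claw-free tc@(_ , (((col , proper) , min) , _) , _) = isoComplete G
  (≤-antisym
    -- On a complete graph the 8-colouring is injective; conversely, the identity is a colouring
    -- with `n G` colours.
    (injective⇒≤ {f = col} λ {u} {v} cu≡cv → decidable-stable (u ≟ v) λ u≢v →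
      proper u v tt tt (complete G claw-free tc u v u≢v) cu≡cv)
    (min (n G) (id , λ _ _ _ _ → Adj⇒≢ G)))
  (complete G claw-free tc)
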